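{- Let $\operatorname{pend}(n)$ denote the number of partitions of $n$ in which no even part appears exactly once (i.e., each even part size that occurs has multiplicity at least $2$; odd parts are unrestricted), and let $\operatorname{pond}(n)$ denote the number of partitions of $n$ in which no odd part appears exactly once (i.e., each odd part size that occurs has multiplicity at least $2$; even parts are unrestricted). Then, as formal power series in $q$, $$\sum_{n\ge 0}(-1)^n \operatorname{pend}(n)q^n=\frac{f_1f_{12}}{f_2^2f_6},\qquad \sum_{n\ge 0}(-1)^n \operatorname{pond}(n)q^n=\frac{f_3f_4}{f_2^2f_6}.$$
   Context: For a positive integer $r$, $f_r:=(q^r;q^r)_\infty=\prod_{k\ge1}(1-q^{rk})$. By convention $\operatorname{pend}(0)=\operatorname{pond}(0)=1$. -}

module Defs where

open import Data.Bool.Base using (if_then_else_)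
open import Data.Empty using (⊥-elim)
open import Data.Fin.Base using (Fin; zero; suc; toℕ)
open import Data.Integer.Base as ℤ using (ℤ; 0ℤ; 1ℤ)
import Data.Integer.Properties as ℤ
open import Data.List.Base
  using (List; []; _∷_; _++_; concatMap; filter; length; map; replicate; upTo)
open import Data.List.Membership.Propositional using (_∈_; find; lose)
open import Data.List.Membership.Propositional.Properties
  using (∈-concatMap⁺; ∈-concatMap⁻; ∈-map⁺; ∈-map⁻; ∈-upTo⁺; ∈-upTo⁻)
open import Data.List.Properties using (++-cancelˡ; ∷-injectiveʳ)
open import Data.List.Relation.Binary.Disjoint.Propositional using (Disjoint)
open import Data.List.Relation.Unary.All as All using (All; []; _∷_)
import Data.List.Relation.Unary.All.Properties as All
open import Data.List.Relation.Unary.AllPairs as AllPairs using (AllPairs; []; _∷_)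
import Data.List.Relation.Unary.AllPairs.Properties as AllPairs
open import Data.List.Relation.Unary.Any using (Any; any?; here)
open import Data.List.Relation.Unary.Unique.Propositional using (Unique)
import Data.List.Relation.Unary.Unique.Propositional.Properties as Unique
open import Data.Nat.Base
open import Data.Nat.DivMod using (_/_; m/n*n≤m; m*n/n≡m; /-monoˡ-≤)
open import Data.Nat.Divisibility using (_∣_; _∣?_)
open import Data.Nat.ListAction using (sum)
open import Data.Nat.Properties
open import Data.Product.Base using (_×_; _,_; ∃-syntax; proj₁; proj₂)
open import Function.Base using (_∘_; id)
open import Function.Bundles using (_⇔_; mk⇔)
open import Relation.Binary.PropositionalEquality
  using (_≡_; _≢_; _≗_; refl; sym; trans; cong; cong₂; subst; module ≡-Reasoning)
open import Relation.Nullary using (¬_; does; yes; no)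
open import Relation.Nullary.Decidable using (¬?; _×-dec_; dec-false)
open import Relation.Unary using (Decidable)

open import Algebra.Properties.Semiring.Sum ℤ.+-*-semiring
  using (sum-syntax; sum-cong-≗)

-- A series is its coefficient sequence, and equality of series is _≗_.
Series : Set
Series = ℕ → ℤ

infixl 7 _⊛_ _÷_
infixl 6 _⊖_

q^_ : ℕ → Series
(q^ m) n = if does (m ≟ n) then 1ℤ else 0ℤ

𝟙 : Series
𝟙 = q^ 0

_⊖_ : Series → Series → Series
(a ⊖ b) n = a n ℤ.- b n

_⊛_ : Series → Series → Series
(a ⊛ b) n = ∑[ i < suc n ] (a (toℕ i) ℤ.* b (n ∸ toℕ i))

-- Entry k of `recipCoeffs a n` is the coefficient of q^(n ∸ k) in 1/a,
-- assuming a has constant term 1.  For any other constant term the result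
-- is meaningless; see `⊛-recip`.
recipCoeffs : Series → (n : ℕ) → Fin (suc n) → ℤ
recipCoeffs a zero    _       = 1ℤ
recipCoeffs a (suc n) zero    =
  ℤ.- (∑[ k < suc n ] (a (suc (toℕ k)) ℤ.* recipCoeffs a n k))
recipCoeffs a (suc n) (suc k) = recipCoeffs a n k

recip : Series → Series
recip a n = recipCoeffs a n zero

_÷_ : Series → Series → Series
a ÷ b = a ⊛ recip b

recipCoeffs≡recip : ∀ a n k → recipCoeffs a n k ≡ recip a (n ∸ toℕ k)
recipCoeffs≡recip a zero    zero    = refl
recipCoeffs≡recip a (suc n) zero    = refl
recipCoeffs≡recip a (suc n) (suc k) = recipCoeffs≡recip a n k

⊛-recip : ∀ a → a 0 ≡ 1ℤ → a ⊛ recip a ≗ 𝟙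
⊛-recip a a₀≡1 zero    rewrite a₀≡1 = refl
⊛-recip a a₀≡1 (suc n) = begin
  a 0 ℤ.* ℤ.- S ℤ.+ S′   ≡⟨ cong₂ ℤ._+_ (cong (ℤ._* (ℤ.- S)) a₀≡1) (sym S≡S′) ⟩
  1ℤ ℤ.* ℤ.- S ℤ.+ S     ≡⟨ cong (ℤ._+ S) (ℤ.*-identityˡ (ℤ.- S)) ⟩
  ℤ.- S ℤ.+ S            ≡⟨ ℤ.+-inverseˡ S ⟩
  0ℤ                     ∎
  where
  open ≡-Reasoning
  S S′ : ℤ
  S  = ∑[ k < suc n ] (a (suc (toℕ k)) ℤ.* recipCoeffs a n k)
  S′ = ∑[ k < suc n ] (a (suc (toℕ k)) ℤ.* recip a (n ∸ toℕ k))
  S≡S′ : S ≡ S′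
  S≡S′ = sum-cong-≗ {suc n} (λ k → cong (a (suc (toℕ k)) ℤ.*_) (recipCoeffs≡recip a n k))

partialProduct : ℕ → ℕ → Series
partialProduct r zero    = 𝟙
partialProduct r (suc N) = partialProduct r N ⊛ (𝟙 ⊖ q^ (r * suc N))

-- f r = ∏_{k ≥ 1} (1 − q^{rk}).  For r ≥ 1 the factors with k > n do not
-- affect the coefficient of q^n, so this is the coefficientwise limit of the
-- partial products; see `partialProduct-stable`.  f 0 is meaningless.
f : ℕ → Series
f r n = partialProduct r n n

⊛-truncate : ∀ a b n → b 0 ≡ 1ℤ → (∀ {k} → 0 < k → k ≤ n → b k ≡ 0ℤ) → (a ⊛ b) n ≡ a n
⊛-truncate a b zero    b₀≡1 _   rewrite b₀≡1 =
  trans (ℤ.+-identityʳ _) (ℤ.*-identityʳ (a 0))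
⊛-truncate a b (suc n) b₀≡1 b≡0 rewrite b≡0 {suc n} z<s ≤-refl | ℤ.*-zeroʳ (a 0) =
  trans (ℤ.+-identityˡ _)
        (⊛-truncate (a ∘ suc) b n b₀≡1 (λ 0<k k≤n → b≡0 0<k (m≤n⇒m≤1+n k≤n)))

q^-≢ : ∀ {m n} → m ≢ n → (q^ m) n ≡ 0ℤ
q^-≢ {m} {n} m≢n rewrite dec-false (m ≟ n) m≢n = refl

partialProduct-stable : ∀ r .{{_ : NonZero r}} {n N} → n ≤ N → partialProduct r N n ≡ f r n
partialProduct-stable r n≤N = go (≤⇒≤′ n≤N)
  where
  go : ∀ {n N} → n ≤′ N → partialProduct r N n ≡ f r n
  go ≤′-refl = refl
  go {n} {suc N} (≤′-step n≤′N) =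
    trans (⊛-truncate (partialProduct r N) (𝟙 ⊖ q^ (r * suc N)) n
             (cong (λ x → 1ℤ ℤ.- x) (q^-≢ (>⇒≢ (n<rsN z≤n))))
             λ { {suc k} _ k<n → cong (λ x → 0ℤ ℤ.- x) (q^-≢ (>⇒≢ (n<rsN k<n))) })
          (go n≤′N)
    where
    n<rsN : ∀ {k} → k ≤ n → k < r * suc N
    n<rsN k≤n = ≤-trans (s≤s (≤-trans k≤n (≤′⇒≤ n≤′N))) (m≤n*m (suc N) r)

record IsPartition (n : ℕ) (p : List ℕ) : Set where
  constructor isPartition
  field
    decreasing : AllPairs _≥_ p
    positive   : All (_> 0) p
    total      : sum p ≡ n

-- The partitions of n with all parts at most m, grouped by the number j of
-- parts equal to m.
boundedPartitions : (m n : ℕ) → List (List ℕ)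
boundedPartitions zero    zero    = [] ∷ []
boundedPartitions zero    (suc n) = []
boundedPartitions (suc m) n       =
  concatMap (λ j → map (replicate j (suc m) ++_) (boundedPartitions m (n ∸ j * suc m)))
            (upTo (suc (n / suc m)))

-- Every partition of n occurs exactly once in `partitions n`; see
-- `∈-partitions` and `partitions-unique`.
partitions : ℕ → List (List ℕ)
partitions n = boundedPartitions n n

multiplicity : ℕ → List ℕ → ℕ
multiplicity k p = length (filter (k ≟_) p)

NoEvenPartOnce NoOddPartOnce : List ℕ → Set
NoEvenPartOnce p = ¬ Any (λ k → 2 ∣ k × multiplicity k p ≡ 1) p
NoOddPartOnce  p = ¬ Any (λ k → ¬ 2 ∣ k × multiplicity k p ≡ 1) p

noEvenPartOnce? : Decidable NoEvenPartOnce
noEvenPartOnce? p = ¬? (any? (λ k → 2 ∣? k ×-dec multiplicity k p ≟ 1) p)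

noOddPartOnce? : Decidable NoOddPartOnce
noOddPartOnce? p = ¬? (any? (λ k → ¬? (2 ∣? k) ×-dec multiplicity k p ≟ 1) p)

pend pond : ℕ → ℕ
pend n = length (filter noEvenPartOnce? (partitions n))
pond n = length (filter noOddPartOnce? (partitions n))

sum-replicate : ∀ j s q → sum (replicate j s ++ q) ≡ j * s + sum q
sum-replicate zero    s q = refl
sum-replicate (suc j) s q =
  trans (cong (_+_ s) (sum-replicate j s q)) (sym (+-assoc s (j * s) (sum q)))

decreasing-replicate : ∀ j s {q} → AllPairs _≥_ q → All (_≤ s) q →
                       AllPairs _≥_ (replicate j s ++ q)
decreasing-replicate zero    s dec _   = dec
decreasing-replicate (suc j) s dec q≤s =
  All.++⁺ (All.replicate⁺ j ≤-refl) q≤s ∷ decreasing-replicate j s dec q≤s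

splitMax : ∀ m {p} → AllPairs _≥_ p → All (_≤ suc m) p →
           ∃[ j ] ∃[ q ] p ≡ replicate j (suc m) ++ q × All (_≤ m) q
splitMax m [] [] = 0 , [] , refl , []
splitMax m {x ∷ p} (x≥p ∷ dec) (x≤1+m ∷ p≤1+m) with x ≟ suc m
... | no  x≢1+m = 0 , x ∷ p , refl , x≤m ∷ All.map (λ y≤x → ≤-trans y≤x x≤m) x≥p
  where x≤m = ≤-pred (≤∧≢⇒< x≤1+m x≢1+m)
... | yes refl with splitMax m dec p≤1+m
... | j , q , refl , q≤m = suc j , q , refl , q≤m

decreasing-++⁻ʳ : ∀ (xs : List ℕ) {ys} → AllPairs _≥_ (xs ++ ys) → AllPairs _≥_ ys
decreasing-++⁻ʳ []       dec       = dec
decreasing-++⁻ʳ (x ∷ xs) (_ ∷ dec) = decreasing-++⁻ʳ xs dec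

parts≤sum : ∀ p → All (_≤ sum p) p
parts≤sum []      = []
parts≤sum (x ∷ p) = m≤m+n x (sum p) ∷ All.map (λ y≤ → ≤-trans y≤ (m≤n+m (sum p) x)) (parts≤sum p)

boundedPartitions-sound : ∀ m n {p} → p ∈ boundedPartitions m n →
                          IsPartition n p × All (_≤ m) p
boundedPartitions-sound zero zero (here refl) = isPartition [] [] refl , []
boundedPartitions-sound (suc m) n p∈
  with find (∈-concatMap⁻ _ {xs = upTo (suc (n / suc m))} p∈)
... | j , j∈ , p∈map with ∈-map⁻ (replicate j (suc m) ++_) p∈map
... | q , q∈ , refl with boundedPartitions-sound m (n ∸ j * suc m) q∈
... | isPartition dec pos tot , q≤m =
  isPartition (decreasing-replicate j (suc m) dec q≤1+m)
              (All.++⁺ (All.replicate⁺ j z<s) pos)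
              (trans (sum-replicate j (suc m) q)
                     (trans (cong (_+_ (j * suc m)) tot) (m+[n∸m]≡n jm≤n)))
  , All.++⁺ (All.replicate⁺ j ≤-refl) q≤1+m
  where
  q≤1+m = All.map m≤n⇒m≤1+n q≤m
  jm≤n : j * suc m ≤ n
  jm≤n = ≤-trans (*-monoˡ-≤ (suc m) (≤-pred (∈-upTo⁻ j∈))) (m/n*n≤m n (suc m))

boundedPartitions-complete : ∀ m n {p} → IsPartition n p → All (_≤ m) p →
                             p ∈ boundedPartitions m n
boundedPartitions-complete zero n (isPartition [] [] refl) [] = here refl
boundedPartitions-complete zero n (isPartition _ (x>0 ∷ _) _) (x≤0 ∷ _) =
  ⊥-elim (<⇒≱ x>0 x≤0)
boundedPartitions-complete (suc m) n (isPartition dec pos tot) p≤1+m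
  with splitMax m dec p≤1+m
... | j , q , refl , q≤m =
  ∈-concatMap⁺ _ (lose (∈-upTo⁺ (s≤s j≤n/m)) (∈-map⁺ (replicate j (suc m) ++_) q∈))
  where
  eq : j * suc m + sum q ≡ n
  eq = trans (sym (sum-replicate j (suc m) q)) tot
  j≤n/m : j ≤ n / suc m
  j≤n/m = subst (_≤ n / suc m) (m*n/n≡m j (suc m))
            (/-monoˡ-≤ (suc m) (subst (j * suc m ≤_) eq (m≤m+n (j * suc m) (sum q))))
  q∈ : q ∈ boundedPartitions m (n ∸ j * suc m)
  q∈ = boundedPartitions-complete m (n ∸ j * suc m)
         (isPartition (decreasing-++⁻ʳ (replicate j (suc m)) dec)
                      (All.++⁻ʳ (replicate j (suc m)) pos)
                      (trans (sym (m+n∸m≡n (j * suc m) (sum q))) (cong (_∸ j * suc m) eq)))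
         q≤m

replicate-++-< : ∀ {i j s q r} → i < j → All (_< s) q →
                 replicate i s ++ q ≢ replicate j s ++ r
replicate-++-< {zero}  {suc j} _   (x<s ∷ _) refl = <-irrefl refl x<s
replicate-++-< {suc i} {suc j} i<j q<s       eq   =
  replicate-++-< (≤-pred i<j) q<s (∷-injectiveʳ eq)

boundedPartitions-unique : ∀ m n → Unique (boundedPartitions m n)
boundedPartitions-unique zero    zero    = [] ∷ []
boundedPartitions-unique zero    (suc n) = []
boundedPartitions-unique (suc m) n       = Unique.concat⁺
  (All.map⁺ (All.universal (λ j → Unique.map⁺ (++-cancelˡ (replicate j (suc m)) _ _)
                                    (boundedPartitions-unique m (n ∸ j * suc m))) _))
  (AllPairs.map⁺ (AllPairs.applyUpTo⁺₁ id (suc (n / suc m)) (λ i<j _ → disjoint i<j)))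
  where
  disjoint : ∀ {i j} → i < j →
    Disjoint (map (replicate i (suc m) ++_) (boundedPartitions m (n ∸ i * suc m)))
             (map (replicate j (suc m) ++_) (boundedPartitions m (n ∸ j * suc m)))
  disjoint {i} {j} i<j (v∈₁ , v∈₂)
    with ∈-map⁻ (replicate i (suc m) ++_) v∈₁ | ∈-map⁻ (replicate j (suc m) ++_) v∈₂
  ... | q , q∈ , refl | r , _ , eq =
    replicate-++-< i<j (All.map s≤s (proj₂ (boundedPartitions-sound m _ q∈))) eq

∈-partitions : ∀ {n p} → p ∈ partitions n ⇔ IsPartition n p
∈-partitions {n} {p} = mk⇔
  (proj₁ ∘ boundedPartitions-sound n n)
  (λ isP → boundedPartitions-complete n n isP
             (subst (λ k → All (_≤ k) p) (IsPartition.total isP) (parts≤sum p)))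

partitions-unique : ∀ n → Unique (partitions n)
partitions-unique n = boundedPartitions-unique n n

{-# OPTIONS --safe #-}

-- Let P m be the generating function, after the substitution q ↦ −q, of the
-- admissible partitions with all parts at most m.  Allowing parts of size k
-- divides it by 1 − z, where z = (−q)^k, if their number is unrestricted, and
-- multiplies it by 1/(1 − z) − z = (1 − z + z²)/(1 − z) if k may not occur
-- exactly once.  With y = q^(2N+1) and x = q^(2N+2), the identities
-- (1 − x + x²)(1 + x) = 1 + x³ and (1 + y + y²)(1 − y) = 1 − y³ make the products
-- telescope exactly, already at every finite level:
--   P (2N) · ∏_{k ≤ 2N} (1 − q^{2k}) · ∏_{k ≤ N} (1 − q^{2k}) · ∏_{k ≤ N} (1 − q^{6k})
--     = ∏_{k ≤ 2N} (1 − q^{ak}) · ∏_{k ≤ N} (1 − q^{bk}),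
-- with (a , b) = (1 , 12) for pend and (3 , 4) for pond.  The coefficients of q^n
-- on both sides are those of the limit as soon as n ≤ N.

module Submission where

open import Defs
open import Data.Integer.Base using (-1ℤ; +_; _*_; _^_)
open import Data.Product.Base using (_×_)
open import Relation.Binary.PropositionalEquality using (_≗_)

open import Algebra.Bundles using (AbelianGroup; CommutativeRing)
import Algebra.Construct.Pointwise as Pointwise
import Algebra.Properties.Semiring.Exp as Exp
import Algebra.Solver.Ring as RingSolver
open import Algebra.Solver.Ring.AlmostCommutativeRing
  using (_-Raw-AlmostCommutative⟶_; fromCommutativeRing)
open import Data.Bool.Base using (if_then_else_)
open import Data.Fin.Base using (toℕ)
import Data.Fin.Properties as Fin
open import Data.Integer.Base as ℤ using (ℤ; 0ℤ; 1ℤ; _+_)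
import Data.Integer.Properties as ℤ
open import Data.Integer.Tactic.RingSolver using (solve-∀)
open import Data.List.Base
  using (List; []; _∷_; _++_; applyUpTo; concatMap; filter; length; map; replicate; upTo)
open import Data.List.Membership.Propositional using (find; lose)
open import Data.List.Properties
  using (++-identityʳ; filter-all; filter-none; filter-++; length-++; length-replicate; map-id;
         map-upTo)
open import Data.List.Relation.Unary.All as All using (All; []; _∷_)
import Data.List.Relation.Unary.All.Properties as All
open import Data.List.Relation.Unary.Any using (Any; any?; here)
import Data.List.Relation.Unary.Any.Properties as Any
open import Data.Maybe.Base using (Maybe; just; nothing)
open import Data.Nat.Base as ℕ using (ℕ; zero; suc; _∸_; _≤_; _<_; NonZero)
open import Data.Nat.Divisibility using (_∣_; _∣?_; ∣-refl; n∣m*n; ∣m+n∣m⇒∣n; ∣1⇒≡1)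
open import Data.Nat.DivMod using (_/_; n/n≡1; m<n⇒m/n≡0; +-distrib-/-∣ˡ)
open import Data.Nat.ListAction using (sum)
import Data.Nat.Properties as ℕ
open import Data.Product.Base using (_,_; proj₁; proj₂)
open import Data.Sum.Base using (inj₁; inj₂)
open import Function.Base using (_∘_; case_of_)
open import Function.Bundles using (_⇔_; mk⇔)
open import Relation.Binary.PropositionalEquality
  using (_≡_; _≢_; refl; sym; trans; cong; cong₂; subst; module ≡-Reasoning)
open import Relation.Nullary using (¬_; does; yes; no)
open import Relation.Nullary.Decidable using (¬?; _×-dec_; does-⇔)
open import Relation.Unary using (Decidable)

open import Algebra.Properties.Semiring.Sum ℤ.+-*-semiring
  using (sum-cong-≗; *-distribˡ-sum)

-- Ring identities behind the telescoping

-- Over an abstract ring, because for Series itself the solver would have to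
-- compare normal forms with every convolution unfolded.
module TelescopingIdentities
  {r ℓ} (R : CommutativeRing r ℓ)
  (fromℤ : ℤ.+-*-rawRing -Raw-AlmostCommutative⟶ fromCommutativeRing R)
  where

  open CommutativeRing R
    using (Carrier; _≈_; setoid; semiring; reflexive; +-congʳ; *-congʳ; *-congˡ)
    renaming (_+_ to _⊞_; _-_ to _⊟_; -_ to ⊟_; _*_ to _⊠_; refl to ≈-refl; trans to ≈-trans)
  open Exp semiring using () renaming (_^_ to _↑_)
  open import Relation.Binary.Reasoning.Setoid setoid

  open _-Raw-AlmostCommutative⟶_ fromℤ using (⟦_⟧)

  ⟦_⟧≟⟦_⟧ : ∀ a b → Maybe (⟦ a ⟧ ≈ ⟦ b ⟧)
  ⟦ a ⟧≟⟦ b ⟧ with a ℤ.≟ b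
  ... | yes a≡b = just (reflexive (cong ⟦_⟧ a≡b))
  ... | no  _   = nothing

  open RingSolver ℤ.+-*-rawRing (fromCommutativeRing R) fromℤ ⟦_⟧≟⟦_⟧
    using (Polynomial; solve; con; _:=_; _:+_; _:*_; _:-_; :-_; _:^_)

  -- Taken as the image of `1ℤ` because this is what the solver's `con 1ℤ` denotes.
  1r : Carrier
  1r = ⟦ 1ℤ ⟧

  :1 : ∀ {n} → Polynomial n
  :1 = con 1ℤ

  κ : Carrier → Carrier
  κ x = 1r ⊟ x ⊞ x ↑ 2

  geometric : ∀ t g x → t ≈ g ⊞ x ⊠ t → t ⊠ (1r ⊟ x) ≈ g
  geometric t g x t≈g+xt = begin
    t ⊠ (1r ⊟ x)       ≈⟨ solve 2 (λ t x → t :* (:1 :- x) := t :- x :* t) ≈-refl t x ⟩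
    t ⊟ x ⊠ t          ≈⟨ +-congʳ t≈g+xt ⟩
    g ⊞ x ⊠ t ⊟ x ⊠ t  ≈⟨ solve 2 (λ g s → g :+ s :- s := g) ≈-refl g (x ⊠ t) ⟩
    g                  ∎

  -- Here `u` is the geometric sum `t` without its term xg. Multiplying t - xg by 1 - x leaves g -
  -- xg(1 - x), which is g(1 - x + x²).
  geometricWithoutLinear : ∀ t g u x → t ≈ g ⊞ x ⊠ t → u ⊞ x ⊠ g ≈ t →
                           u ⊠ (1r ⊟ x) ≈ g ⊠ κ x
  geometricWithoutLinear t g u x t≈g+xt u+xg≈t = begin
    u ⊠ (1r ⊟ x)
      ≈⟨ solve 3 (λ g u x → u :* (:1 :- x) := (u :+ x :* g) :* (:1 :- x) :- x :* g :* (:1 :- x))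
           ≈-refl g u x ⟩
    (u ⊞ x ⊠ g) ⊠ (1r ⊟ x) ⊟ x ⊠ g ⊠ (1r ⊟ x)
      ≈⟨ +-congʳ (≈-trans (*-congʳ u+xg≈t) (geometric t g x t≈g+xt)) ⟩
    g ⊟ x ⊠ g ⊠ (1r ⊟ x)
      ≈⟨ solve 2 (λ g x → g :- x :* g :* (:1 :- x) := g :* (:1 :- x :+ x :^ 2)) ≈-refl g x ⟩
    g ⊠ κ x ∎

  -- A form of p₂ = p₀b/a free of division: the denominator `d` is enlarged by a multiple `a ⊠ c` of
  -- `a`, so that `a` can be traded for `b` and the cofactor `c` is carried along.
  exchange : ∀ {p₀ p₂ a b d n} c → p₂ ⊠ a ≈ p₀ ⊠ b → p₀ ⊠ d ≈ n →
             p₂ ⊠ (d ⊠ (a ⊠ c)) ≈ n ⊠ (b ⊠ c)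
  exchange {p₀} {p₂} {a} {b} {d} {n} c p₂a≈p₀b p₀d≈n = begin
    p₂ ⊠ (d ⊠ (a ⊠ c))  ≈⟨ solve 4 (λ p d a c → p :* (d :* (a :* c)) := p :* a :* (d :* c))
                             ≈-refl p₂ d a c ⟩
    p₂ ⊠ a ⊠ (d ⊠ c)    ≈⟨ *-congʳ p₂a≈p₀b ⟩
    p₀ ⊠ b ⊠ (d ⊠ c)    ≈⟨ solve 4 (λ p d b c → p :* b :* (d :* c) := p :* d :* (b :* c))
                             ≈-refl p₀ d b c ⟩
    p₀ ⊠ d ⊠ (b ⊠ c)    ≈⟨ *-congʳ p₀d≈n ⟩
    n ⊠ (b ⊠ c)         ∎

  -- p₀, p₁, p₂ play the roles of P (2N), P (2N+1), P (2N+2); the signed monomials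
  -- for the two new part sizes are − y and x.
  module _ (p₀ p₁ p₂ d₁ d₂ d₃ n₁ n₂ y x : Carrier)
           (p₀d≈n : p₀ ⊠ (d₁ ⊠ d₂ ⊠ d₃) ≈ n₁ ⊠ n₂) where

    private
      d′ a c : Carrier
      d′ = d₁ ⊠ (1r ⊟ y ↑ 2) ⊠ (1r ⊟ x ↑ 2) ⊠ (d₂ ⊠ (1r ⊟ x)) ⊠ (d₃ ⊠ (1r ⊟ x ↑ 3))
      a = (1r ⊟ (⊟ y)) ⊠ (1r ⊟ x)
      c = (1r ⊟ y) ⊠ (1r ⊟ x ↑ 2) ⊠ (1r ⊟ x ↑ 3)

      -- The only factor to be split is 1 - y² = (1 + y)(1 - y): `a` takes 1 + y together with the
      -- factor 1 - x, and `c` the rest.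
      d′≈ : d′ ≈ d₁ ⊠ d₂ ⊠ d₃ ⊠ (a ⊠ c)
      d′≈ = solve 5 (λ d₁ d₂ d₃ y x →
        d₁ :* (:1 :- y :^ 2) :* (:1 :- x :^ 2) :* (d₂ :* (:1 :- x)) :* (d₃ :* (:1 :- x :^ 3)) :=
        d₁ :* d₂ :* d₃ :*
          ((:1 :- (:- y)) :* (:1 :- x) :* ((:1 :- y) :* (:1 :- x :^ 2) :* (:1 :- x :^ 3))))
        ≈-refl d₁ d₂ d₃ y x

    pendStep : p₁ ⊠ (1r ⊟ (⊟ y)) ≈ p₀ → p₂ ⊠ (1r ⊟ x) ≈ p₁ ⊠ κ x →
               p₂ ⊠ d′ ≈ n₁ ⊠ (1r ⊟ y) ⊠ (1r ⊟ x) ⊠ (n₂ ⊠ (1r ⊟ x ↑ 6))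
    pendStep p₁≈ p₂≈ = begin
      p₂ ⊠ d′
        ≈⟨ *-congˡ d′≈ ⟩
      p₂ ⊠ (d₁ ⊠ d₂ ⊠ d₃ ⊠ (a ⊠ c))
        ≈⟨ exchange c p₂a≈p₀b p₀d≈n ⟩
      n₁ ⊠ n₂ ⊠ (κ x ⊠ c)
        -- (1 - x + x²)(1 - x²) = (1 - x)(1 + x³), and 1 + x³ combines with 1 - x³ to 1 - x⁶.
        ≈⟨ solve 4 (λ n₁ n₂ y x →
             n₁ :* n₂ :* ((:1 :- x :+ x :^ 2) :* ((:1 :- y) :* (:1 :- x :^ 2) :* (:1 :- x :^ 3))) :=
             n₁ :* (:1 :- y) :* (:1 :- x) :* (n₂ :* (:1 :- x :^ 6)))
             ≈-refl n₁ n₂ y x ⟩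
      n₁ ⊠ (1r ⊟ y) ⊠ (1r ⊟ x) ⊠ (n₂ ⊠ (1r ⊟ x ↑ 6)) ∎
      where
      p₂a≈p₀b : p₂ ⊠ a ≈ p₀ ⊠ κ x
      p₂a≈p₀b = begin
        p₂ ⊠ a
          ≈⟨ solve 3 (λ p s t → p :* (s :* t) := p :* t :* s) ≈-refl p₂ _ _ ⟩
        p₂ ⊠ (1r ⊟ x) ⊠ (1r ⊟ (⊟ y)) ≈⟨ *-congʳ p₂≈ ⟩
        p₁ ⊠ κ x ⊠ (1r ⊟ (⊟ y))
          ≈⟨ solve 3 (λ p s t → p :* s :* t := p :* t :* s) ≈-refl p₁ _ _ ⟩
        p₁ ⊠ (1r ⊟ (⊟ y)) ⊠ κ x      ≈⟨ *-congʳ p₁≈ ⟩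
        p₀ ⊠ κ x                     ∎

    pondStep : p₁ ⊠ (1r ⊟ (⊟ y)) ≈ p₀ ⊠ κ (⊟ y) → p₂ ⊠ (1r ⊟ x) ≈ p₁ →
               p₂ ⊠ d′ ≈ n₁ ⊠ (1r ⊟ y ↑ 3) ⊠ (1r ⊟ x ↑ 3) ⊠ (n₂ ⊠ (1r ⊟ x ↑ 2))
    pondStep p₁≈ p₂≈ = begin
      p₂ ⊠ d′
        ≈⟨ *-congˡ d′≈ ⟩
      p₂ ⊠ (d₁ ⊠ d₂ ⊠ d₃ ⊠ (a ⊠ c))
        ≈⟨ exchange c p₂a≈p₀b p₀d≈n ⟩
      n₁ ⊠ n₂ ⊠ (κ (⊟ y) ⊠ c)
        -- (1 + y + y²)(1 - y) = 1 - y³; of the other two factors of `c`, 1 - x³ joins `n₁` and 1 -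
        -- x² joins `n₂`.
        ≈⟨ solve 4 (λ n₁ n₂ y x →
             n₁ :* n₂ :* ((:1 :- (:- y) :+ (:- y) :^ 2) :*
               ((:1 :- y) :* (:1 :- x :^ 2) :* (:1 :- x :^ 3))) :=
             n₁ :* (:1 :- y :^ 3) :* (:1 :- x :^ 3) :* (n₂ :* (:1 :- x :^ 2)))
             ≈-refl n₁ n₂ y x ⟩
      n₁ ⊠ (1r ⊟ y ↑ 3) ⊠ (1r ⊟ x ↑ 3) ⊠ (n₂ ⊠ (1r ⊟ x ↑ 2)) ∎
      where
      p₂a≈p₀b : p₂ ⊠ a ≈ p₀ ⊠ κ (⊟ y)
      p₂a≈p₀b = begin
        p₂ ⊠ a
          ≈⟨ solve 3 (λ p s t → p :* (s :* t) := p :* t :* s) ≈-refl p₂ _ _ ⟩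
        p₂ ⊠ (1r ⊟ x) ⊠ (1r ⊟ (⊟ y)) ≈⟨ *-congʳ p₂≈ ⟩
        p₁ ⊠ (1r ⊟ (⊟ y))            ≈⟨ p₁≈ ⟩
        p₀ ⊠ κ (⊟ y)                 ∎

-- The commutative ring of formal power series

+-group : AbelianGroup _ _
+-group = Pointwise.abelianGroup ℕ ℤ.+-0-abelianGroup

open AbelianGroup +-group using () renaming (_∙_ to _⊕_; ε to 𝟘; _⁻¹ to ⊖_)

-- The indices in a convolution never exceed its degree. Hypotheses and conclusion have the same
-- truncated shape, so uses can be nested; this is what allows infinite products to be replaced by
-- finite ones.
⊛-cong-≤ : ∀ {a a′ b b′ : Series} n →
           (∀ {k} → k ≤ n → a k ≡ a′ k) → (∀ {k} → k ≤ n → b k ≡ b′ k) →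
           ∀ {k} → k ≤ n → (a ⊛ b) k ≡ (a′ ⊛ b′) k
⊛-cong-≤ n a≡a′ b≡b′ {k} k≤n = sum-cong-≗ {suc k} λ i →
  cong₂ _*_ (a≡a′ (ℕ.≤-trans (ℕ.≤-pred (Fin.toℕ<n i)) k≤n))
            (b≡b′ (ℕ.≤-trans (ℕ.m∸n≤m k (toℕ i)) k≤n))

⊛-cong : ∀ {a a′ b b′} → a ≗ a′ → b ≗ b′ → a ⊛ b ≗ a′ ⊛ b′
⊛-cong {a} {a′} {b} {b′} a≗a′ b≗b′ n =
  ⊛-cong-≤ {a} {a′} {b} {b′} n (λ {k} _ → a≗a′ k) (λ {k} _ → b≗b′ k) ℕ.≤-refl

⊛-congˡ : ∀ a {b b′} → b ≗ b′ → a ⊛ b ≗ a ⊛ b′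
⊛-congˡ a = ⊛-cong {a} λ _ → refl

⊛-congʳ : ∀ b {a a′} → a ≗ a′ → a ⊛ b ≗ a′ ⊛ b
⊛-congʳ b a≗a′ = ⊛-cong {b = b} a≗a′ λ _ → refl

infixr 8 _·_
_·_ : ℤ → Series → Series
(c · a) n = c * a n

⊛-distribʳ : ∀ c a b → (a ⊕ b) ⊛ c ≗ (a ⊛ c) ⊕ (b ⊛ c)
⊛-distribʳ c a b zero    = lemma (a 0) (b 0) (c 0)
  where
  lemma : ∀ a b c → (a + b) * c + 0ℤ ≡ (a * c + 0ℤ) + (b * c + 0ℤ)
  lemma = solve-∀
⊛-distribʳ c a b (suc n) =
  trans (cong (_+_ (((a 0 + b 0) * c (suc n)))) (⊛-distribʳ c (a ∘ suc) (b ∘ suc) n))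
        (lemma (a 0) (b 0) (c (suc n)) _ _)
  where
  lemma : ∀ a b c s t → (a + b) * c + (s + t) ≡ (a * c + s) + (b * c + t)
  lemma = solve-∀

·-⊛ : ∀ z a b → (z · a) ⊛ b ≗ z · (a ⊛ b)
·-⊛ z a b zero    = lemma z (a 0) (b 0)
  where
  lemma : ∀ z a b → (z * a) * b + 0ℤ ≡ z * (a * b + 0ℤ)
  lemma = solve-∀
·-⊛ z a b (suc n) =
  trans (cong (_+_ (((z * a 0) * b (suc n)))) (·-⊛ z (a ∘ suc) b n)) (lemma z (a 0) (b (suc n)) _)
  where
  lemma : ∀ z a b s → (z * a) * b + z * s ≡ z * (a * b + s)
  lemma = solve-∀

-- By induction along the tail: the tail of a ⊛ b is a 0 · (b ∘ suc) ⊕ (a ∘ suc) ⊛ b.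
⊛-assoc : ∀ a b c → (a ⊛ b) ⊛ c ≗ a ⊛ (b ⊛ c)
⊛-assoc a b c zero    = lemma (a 0) (b 0) (c 0)
  where
  lemma : ∀ a b c → (a * b + 0ℤ) * c + 0ℤ ≡ a * (b * c + 0ℤ) + 0ℤ
  lemma = solve-∀
⊛-assoc a b c (suc n) = begin
  (a 0 * b 0 + 0ℤ) * c (suc n) + (((a 0 · (b ∘ suc)) ⊕ ((a ∘ suc) ⊛ b)) ⊛ c) n
    ≡⟨ cong (_+_ ((a 0 * b 0 + 0ℤ) * c (suc n)))
         (trans (⊛-distribʳ c (a 0 · (b ∘ suc)) ((a ∘ suc) ⊛ b) n)
                (cong₂ _+_ (·-⊛ (a 0) (b ∘ suc) c n) (⊛-assoc (a ∘ suc) b c n))) ⟩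
  (a 0 * b 0 + 0ℤ) * c (suc n) + (a 0 * ((b ∘ suc) ⊛ c) n + ((a ∘ suc) ⊛ (b ⊛ c)) n)
    ≡⟨ lemma (a 0) (b 0) (c (suc n)) _ _ ⟩
  a 0 * (b 0 * c (suc n) + ((b ∘ suc) ⊛ c) n) + ((a ∘ suc) ⊛ (b ⊛ c)) n ∎
  where
  open ≡-Reasoning
  lemma : ∀ a b c s t → (a * b + 0ℤ) * c + (a * s + t) ≡ a * (b * c + s) + t
  lemma = solve-∀

-- Peeling off the first term of both factors leaves the convolution of the two tails, two degrees
-- lower; hence the separate case of degree 1.
⊛-comm : ∀ a b → a ⊛ b ≗ b ⊛ a
⊛-comm a b zero          = cong (_+ 0ℤ) (ℤ.*-comm (a 0) (b 0))
⊛-comm a b (suc zero)    = lemma (a 0) (a 1) (b 0) (b 1)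
  where
  lemma : ∀ a a′ b b′ → a * b′ + (a′ * b + 0ℤ) ≡ b * a′ + (b′ * a + 0ℤ)
  lemma = solve-∀
⊛-comm a b (suc (suc n)) = begin
  a 0 * b (2 ℕ.+ n) + ((a ∘ suc) ⊛ b) (suc n)
    ≡⟨ cong (_+_ (a 0 * b (2 ℕ.+ n))) (⊛-comm (a ∘ suc) b (suc n)) ⟩
  a 0 * b (2 ℕ.+ n) + (b 0 * a (2 ℕ.+ n) + ((b ∘ suc) ⊛ (a ∘ suc)) n)
    ≡⟨ lemma (a 0 * b (2 ℕ.+ n)) (b 0 * a (2 ℕ.+ n)) _ ⟩
  b 0 * a (2 ℕ.+ n) + (a 0 * b (2 ℕ.+ n) + ((b ∘ suc) ⊛ (a ∘ suc)) n)
    ≡⟨ cong (λ s → b 0 * a (2 ℕ.+ n) + (a 0 * b (2 ℕ.+ n) + s)) (⊛-comm (b ∘ suc) (a ∘ suc) n) ⟩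
  b 0 * a (2 ℕ.+ n) + (a 0 * b (2 ℕ.+ n) + ((a ∘ suc) ⊛ (b ∘ suc)) n)
    ≡⟨ cong (_+_ (b 0 * a (2 ℕ.+ n))) (⊛-comm (b ∘ suc) a (suc n)) ⟨
  b 0 * a (2 ℕ.+ n) + ((b ∘ suc) ⊛ a) (suc n) ∎
  where
  open ≡-Reasoning
  lemma : ∀ s t u → s + (t + u) ≡ t + (s + u)
  lemma = solve-∀

-- Shaped like `q^_`, so that `constant 1ℤ` is `𝟙` by definition.
constant : ℤ → Series
constant c n = if does (0 ℕ.≟ n) then c else 0ℤ

⊛-zeroˡ : ∀ a → 𝟘 ⊛ a ≗ 𝟘
⊛-zeroˡ a zero    = refl
⊛-zeroˡ a (suc n) = trans (ℤ.+-identityˡ _) (⊛-zeroˡ a n)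

constant-⊛ : ∀ c a → constant c ⊛ a ≗ c · a
constant-⊛ c a zero    = ℤ.+-identityʳ (c * a 0)
constant-⊛ c a (suc n) = trans (cong (_+_ (c * a (suc n))) (⊛-zeroˡ a n)) (ℤ.+-identityʳ _)

⊛-identityˡ : ∀ a → 𝟙 ⊛ a ≗ a
⊛-identityˡ a n = trans (constant-⊛ 1ℤ a n) (ℤ.*-identityˡ (a n))

seriesRing : CommutativeRing _ _
seriesRing = record
  { Carrier = Series ; _≈_ = _≗_ ; _+_ = _⊕_ ; _*_ = _⊛_ ; -_ = ⊖_ ; 0# = 𝟘 ; 1# = 𝟙
  ; isCommutativeRing = record
    { isRing = record
      { +-isAbelianGroup = AbelianGroup.isAbelianGroup +-group
      ; *-cong           = ⊛-cong
      ; *-assoc          = ⊛-assoc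
      ; *-identity       = comm∧idˡ⇒id ⊛-comm ⊛-identityˡ
      ; distrib          = comm∧distrʳ⇒distr ⊕-cong ⊛-comm ⊛-distribʳ
      }
    ; *-comm = ⊛-comm
    }
  }
  where
  open AbelianGroup +-group using (setoid) renaming (∙-cong to ⊕-cong)
  open import Algebra.Consequences.Setoid setoid using (comm∧idˡ⇒id; comm∧distrʳ⇒distr)

constant-homomorphism : ℤ.+-*-rawRing -Raw-AlmostCommutative⟶ fromCommutativeRing seriesRing
constant-homomorphism = record
  { ⟦_⟧    = constant
  ; +-homo = λ { c d zero → refl ; c d (suc n) → refl }
  ; *-homo = λ { c d n → sym (trans (constant-⊛ c (constant d) n) (·-constant c d n)) }
  ; -‿homo = λ { c zero → refl ; c (suc n) → refl }
  ; 0-homo = λ { zero → refl ; (suc n) → refl }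
  ; 1-homo = λ n → refl
  }
  where
  ·-constant : ∀ c d → c · constant d ≗ constant (c * d)
  ·-constant c d zero    = refl
  ·-constant c d (suc n) = ℤ.*-zeroʳ c

open TelescopingIdentities seriesRing constant-homomorphism

infixr 8 _↑_
_↑_ : Series → ℕ → Series
_↑_ = Exp._^_ (CommutativeRing.semiring seriesRing)

-- Monomials as shifts

-- The constant term of `q^ suc k` is 0 and its tail is `q^ k` by computation, so each induction
-- step strips one shift.
q^-+ : ∀ k l → q^ (k ℕ.+ l) ≗ q^ k ⊛ q^ l
q^-+ zero    l n       = sym (⊛-identityˡ (q^ l) n)
q^-+ (suc k) l zero    = refl
q^-+ (suc k) l (suc n) = trans (q^-+ k l n) (sym (ℤ.+-identityˡ _))

q^-* : ∀ k l → q^ (k ℕ.* l) ≗ (q^ l) ↑ k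
q^-* zero    l n = refl
q^-* (suc k) l n = trans (q^-+ l (k ℕ.* l) n) (⊛-congˡ (q^ l) (q^-* k l) n)

q^⊛-< : ∀ {k n} a → n < k → (q^ k ⊛ a) n ≡ 0ℤ
q^⊛-< {suc k} {zero}  a _         = refl
q^⊛-< {suc k} {suc n} a (ℕ.s≤s n<k) = trans (ℤ.+-identityˡ _) (q^⊛-< a n<k)

q^⊛-+ : ∀ k n a → (q^ k ⊛ a) (k ℕ.+ n) ≡ a n
q^⊛-+ zero    n a = ⊛-identityˡ a n
q^⊛-+ (suc k) n a = trans (ℤ.+-identityˡ _) (q^⊛-+ k n a)

-- The sign substitution as a ring homomorphism

-- The substitution q ↦ −q.
signed : Series → Series
signed a n = -1ℤ ^ n * a n

signed-cong : ∀ {a b} → a ≗ b → signed a ≗ signed b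
signed-cong a≗b n = cong (-1ℤ ^ n *_) (a≗b n)

signed-⊛ : ∀ a b → signed (a ⊛ b) ≗ signed a ⊛ signed b
signed-⊛ a b n =
  trans (*-distribˡ-sum {suc n} (-1ℤ ^ n) (λ i → a (toℕ i) * b (n ∸ toℕ i)))
        (sum-cong-≗ {suc n} λ i → distribute (toℕ i) (ℕ.≤-pred (Fin.toℕ<n i)))
  where
  lemma : ∀ s t a b → s * t * (a * b) ≡ s * a * (t * b)
  lemma = solve-∀
  distribute : ∀ i → i ≤ n → -1ℤ ^ n * (a i * b (n ∸ i)) ≡ signed a i * signed b (n ∸ i)
  distribute i i≤n = trans
    (cong (_* (a i * b (n ∸ i)))
      (trans (cong (-1ℤ ^_) (sym (ℕ.m+[n∸m]≡n i≤n))) (ℤ.^-distribˡ-+-* -1ℤ i (n ∸ i))))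
    (lemma (-1ℤ ^ i) (-1ℤ ^ (n ∸ i)) (a i) (b (n ∸ i)))

signed-𝟙⊖ : ∀ a → signed (𝟙 ⊖ a) ≗ 𝟙 ⊖ signed a
signed-𝟙⊖ a zero    = lemma (a 0)
  where
  lemma : ∀ x → 1ℤ * (1ℤ ℤ.- x) ≡ 1ℤ ℤ.- 1ℤ * x
  lemma = solve-∀
signed-𝟙⊖ a (suc n) = lemma (-1ℤ ^ suc n) (a (suc n))
  where
  lemma : ∀ s x → s * (0ℤ ℤ.- x) ≡ 0ℤ ℤ.- s * x
  lemma = solve-∀

signed-⊛-𝟙⊖ : ∀ a b x → a ⊛ (𝟙 ⊖ x) ≗ b → signed a ⊛ (𝟙 ⊖ signed x) ≗ signed b
signed-⊛-𝟙⊖ a b x eq n =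
  trans (⊛-congˡ (signed a) (λ k → sym (signed-𝟙⊖ x k)) n)
        (trans (sym (signed-⊛ a (𝟙 ⊖ x) n)) (signed-cong eq n))

signed-κ : ∀ a → signed (κ a) ≗ κ (signed a)
signed-κ a n = begin
  -1ℤ ^ n * ((𝟙 ⊖ a) n + (a ↑ 2) n)          ≡⟨ ℤ.*-distribˡ-+ (-1ℤ ^ n) _ _ ⟩
  signed (𝟙 ⊖ a) n + signed (a ⊛ (a ⊛ 𝟙)) n  ≡⟨ cong₂ _+_ (signed-𝟙⊖ a n) (signed-square n) ⟩
  (𝟙 ⊖ signed a) n + (signed a ↑ 2) n        ∎
  where
  open ≡-Reasoning
  signed-𝟙 : signed 𝟙 ≗ 𝟙
  signed-𝟙 zero    = refl
  signed-𝟙 (suc n) = ℤ.*-zeroʳ (-1ℤ ^ suc n)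
  signed-square : signed (a ↑ 2) ≗ signed a ↑ 2
  signed-square n = trans (signed-⊛ a (a ⊛ 𝟙) n) (⊛-congˡ (signed a)
    (λ k → trans (signed-⊛ a 𝟙 k) (⊛-congˡ (signed a) signed-𝟙 k)) n)

signed-q^ : ∀ k → signed (q^ k) ≗ (-1ℤ ^ k) · (q^ k)
signed-q^ k n with k ℕ.≟ n
... | yes refl = refl
... | no  k≢n  = trans (annihilates (-1ℤ ^ n)) (sym (annihilates (-1ℤ ^ k)))
  where
  annihilates : ∀ c → c * (q^ k) n ≡ 0ℤ
  annihilates c = trans (cong (c *_) (q^-≢ k≢n)) (ℤ.*-zeroʳ c)

-- Counting in lists, and multiplicities

length-filter-concatMap : ∀ {A B : Set} {P : B → Set} (P? : Decidable P) (g : A → List B) xs →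
  length (filter P? (concatMap g xs)) ≡ sum (map (λ x → length (filter P? (g x))) xs)
length-filter-concatMap P? g []       = refl
length-filter-concatMap P? g (x ∷ xs) =
  trans (cong length (filter-++ P? (g x) (concatMap g xs)))
        (trans (length-++ (filter P? (g x)))
               (cong (length (filter P? (g x)) ℕ.+_) (length-filter-concatMap P? g xs)))

length-filter-map : ∀ {A : Set} {P : A → Set} (P? : Decidable P) (g : A → A) {xs} →
  All (λ x → P x ⇔ P (g x)) xs → length (filter P? (map g xs)) ≡ length (filter P? xs)
length-filter-map P? g []                  = refl
length-filter-map P? g {x ∷ xs} (iff ∷ iffs) with P? x | P? (g x) | does-⇔ iff (P? x) (P? (g x))
... | yes _ | yes _ | _ = cong suc (length-filter-map P? g iffs)
... | no _  | no _  | _ = length-filter-map P? g iffs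

applyUpTo-cong : ∀ {A : Set} {g h : ℕ → A} → g ≗ h → applyUpTo g ≗ applyUpTo h
applyUpTo-cong g≗h zero    = refl
applyUpTo-cong g≗h (suc n) = cong₂ _∷_ (g≗h 0) (applyUpTo-cong (g≗h ∘ suc) n)

multiplicity-absent : ∀ {k p} → All (k ≢_) p → multiplicity k p ≡ 0
multiplicity-absent {k} k∉p = cong length (filter-none (k ℕ.≟_) k∉p)

multiplicity-++ : ∀ k p r → multiplicity k (p ++ r) ≡ multiplicity k p ℕ.+ multiplicity k r
multiplicity-++ k p r = trans (cong length (filter-++ (k ℕ.≟_) p r)) (length-++ (filter (k ℕ.≟_) p))

multiplicity-replicate-++-≡ : ∀ j {s q} → All (s ≢_) q → multiplicity s (replicate j s ++ q) ≡ j
multiplicity-replicate-++-≡ j {s} {q} s∉q = begin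
  multiplicity s (replicate j s ++ q)
    ≡⟨ multiplicity-++ s (replicate j s) q ⟩
  multiplicity s (replicate j s) ℕ.+ multiplicity s q
    ≡⟨ cong₂ ℕ._+_ (cong length (filter-all (s ℕ.≟_) (All.replicate⁺ j refl)))
         (multiplicity-absent s∉q) ⟩
  length (replicate j s) ℕ.+ 0
    ≡⟨ trans (ℕ.+-identityʳ _) (length-replicate j) ⟩
  j ∎
  where open ≡-Reasoning

multiplicity-replicate-++-≢ : ∀ j {k s q} → k ≢ s →
                               multiplicity k (replicate j s ++ q) ≡ multiplicity k q
multiplicity-replicate-++-≢ j {k} {s} {q} k≢s =
  trans (multiplicity-++ k (replicate j s) q)
        (cong (ℕ._+ multiplicity k q) (multiplicity-absent (All.replicate⁺ j k≢s)))

-- Coefficients of a geometric sum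

-- The coefficient of q^n in G/(1 - q^s), where G is the generating function of `g`.
sumMultiples : (s : ℕ) .{{_ : NonZero s}} → (ℕ → ℕ) → ℕ → ℕ
sumMultiples s g n = sum (applyUpTo (λ j → g (n ∸ j ℕ.* s)) (suc (n / s)))

[s+n]/s≡1+n/s : ∀ s .{{_ : NonZero s}} n → (s ℕ.+ n) / s ≡ suc (n / s)
[s+n]/s≡1+n/s s n = trans (+-distrib-/-∣ˡ n ∣-refl) (cong (ℕ._+ n / s) (n/n≡1 s))

sumMultiples-< : ∀ {s n} .{{_ : NonZero s}} g → n < s → sumMultiples s g n ≡ g n
sumMultiples-< g n<s rewrite m<n⇒m/n≡0 n<s = ℕ.+-identityʳ _

sumMultiples-+ : ∀ s .{{_ : NonZero s}} n g →
                 sumMultiples s g (s ℕ.+ n) ≡ g (s ℕ.+ n) ℕ.+ sumMultiples s g n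
sumMultiples-+ s n g rewrite [s+n]/s≡1+n/s s n =
  cong (λ xs → g (s ℕ.+ n) ℕ.+ sum xs)
    (applyUpTo-cong (λ j → cong g (ℕ.[m+n]∸[m+o]≡n∸o s n (j ℕ.* s))) (suc (n / s)))

-- The case split matching multiplication by q^s, which vanishes below degree s and reads off the
-- coefficient of degree n at s + n.
byShift : ∀ s {P : ℕ → Set} → (∀ {n} → n < s → P n) → (∀ n → P (s ℕ.+ n)) → ∀ n → P n
byShift s {P} below above n with n ℕ.<? s
... | yes n<s = below n<s
... | no  n≮s = subst P (ℕ.m+[n∸m]≡n (ℕ.≮⇒≥ n≮s)) (above (n ∸ s))

-- Partitions in which no part size from a class C occurs exactly once

module NoPartOnce {C : ℕ → Set} (C? : Decidable C) where

  Once : List ℕ → ℕ → Set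
  Once p k = C k × multiplicity k p ≡ 1

  -- Has the same body as `noEvenPartOnce?` and `noOddPartOnce?`, so that for the two parity classes
  -- `count n n` is `pend n` or `pond n` by definition.
  noneOnce? : Decidable (λ p → ¬ Any (Once p) p)
  noneOnce? p = ¬? (any? (λ k → C? k ×-dec multiplicity k p ℕ.≟ 1) p)

  -- As `s` is absent from `q`, it has multiplicity `j` in the longer list, and the parts of `q`
  -- keep their multiplicities. Only a single copy of a restricted `s` could create a violation.
  noneOnce-replicate-++ : ∀ j {s q} → All (s ≢_) q → ¬ (C s × j ≡ 1) →
    (¬ Any (Once q) q) ⇔ (¬ Any (Once (replicate j s ++ q)) (replicate j s ++ q))
  noneOnce-replicate-++ j {s} {q} s∉q ¬Cs×j≡1 = mk⇔ to from
    where
    p : List ℕ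
    p = replicate j s ++ q
    to : ¬ Any (Once q) q → ¬ Any (Once p) p
    to none once with Any.++⁻ (replicate j s) once
    ... | inj₁ once₁ = All.lookupWith
      (λ { refl (Cs , m≡1) → ¬Cs×j≡1 (Cs , trans (sym (multiplicity-replicate-++-≡ j s∉q)) m≡1) })
      (All.replicate⁺ {P = s ≡_} j refl) once₁
    ... | inj₂ once₂ with find once₂
    ... | k , k∈q , Ck , m≡1 = none (lose k∈q
      (Ck , trans (sym (multiplicity-replicate-++-≢ j (All.lookup s∉q k∈q ∘ sym))) m≡1))
    from : ¬ Any (Once p) p → ¬ Any (Once q) q
    from none once with find once
    ... | k , k∈q , Ck , m≡1 = none (Any.++⁺ʳ (replicate j s) (lose k∈q
      (Ck , trans (multiplicity-replicate-++-≢ j (All.lookup s∉q k∈q ∘ sym)) m≡1)))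

  count : ℕ → ℕ → ℕ
  count m n = length (filter noneOnce? (boundedPartitions m n))

  suc-m∉ : ∀ m n → All (All (suc m ≢_)) (boundedPartitions m n)
  suc-m∉ m n = All.tabulate λ p∈ →
    All.map (λ k≤m → ℕ.>⇒≢ (ℕ.s≤s k≤m)) (proj₂ (boundedPartitions-sound m n p∈))

  -- For `j * suc m ≤ n`, the partitions with exactly `j` parts equal to `suc m`. The case j = 0, in
  -- which `suc m` does not occur, is included.
  countWithLargest : ℕ → ℕ → ℕ → ℕ
  countWithLargest m n j =
    length (filter noneOnce?
      (map (replicate j (suc m) ++_) (boundedPartitions m (n ∸ j ℕ.* suc m))))

  count-suc : ∀ m n → count (suc m) n ≡ sum (applyUpTo (countWithLargest m n) (suc (n / suc m)))
  count-suc m n = trans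
    (length-filter-concatMap noneOnce?
      (λ j → map (replicate j (suc m) ++_) (boundedPartitions m (n ∸ j ℕ.* suc m)))
      (upTo (suc (n / suc m))))
    (cong sum (map-upTo (countWithLargest m n) (suc (n / suc m))))

  countWithLargest-allowed : ∀ m n j → ¬ (C (suc m) × j ≡ 1) →
                             countWithLargest m n j ≡ count m (n ∸ j ℕ.* suc m)
  countWithLargest-allowed m n j ok = length-filter-map noneOnce? _
    (All.map (λ sm∉ → noneOnce-replicate-++ j sm∉ ok) (suc-m∉ m _))

  countWithLargest-once : ∀ m n → C (suc m) → countWithLargest m n 1 ≡ 0
  countWithLargest-once m n Csm = cong length (filter-none noneOnce?
    (All.map⁺ (All.map (λ sm∉ none → none (here (Csm , multiplicity-replicate-++-≡ 1 sm∉)))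
                       (suc-m∉ m _))))

  count-free : ∀ m → ¬ C (suc m) → count (suc m) ≗ sumMultiples (suc m) (count m)
  count-free m ¬C n = trans (count-suc m n)
    (cong sum (applyUpTo-cong (λ j → countWithLargest-allowed m n j (¬C ∘ proj₁))
                              (suc (n / suc m))))

  count-restricted-< : ∀ m {n} → n < suc m → count (suc m) n ≡ count m n
  count-restricted-< m {n} n<sm = trans (count-suc m n) lemma
    where
    lemma : sum (applyUpTo (countWithLargest m n) (suc (n / suc m))) ≡ count m n
    lemma rewrite m<n⇒m/n≡0 n<sm =
      trans (ℕ.+-identityʳ _) (countWithLargest-allowed m n 0 λ ())

  -- The j = 1 term, worth `count m n` in `sumMultiples`, is 0 in the restricted count. Adding it
  -- back avoids truncated subtraction.
  count-restricted-+ : ∀ m n → C (suc m) →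
    count (suc m) (suc m ℕ.+ n) ℕ.+ count m n ≡ sumMultiples (suc m) (count m) (suc m ℕ.+ n)
  count-restricted-+ m n Csm = begin
    count (suc m) N ℕ.+ count m n
      ≡⟨ cong (ℕ._+ count m n) (count-suc m N) ⟩
    sum (applyUpTo (countWithLargest m N) (suc (N / suc m))) ℕ.+ count m n
      ≡⟨ cong (λ k → sum (applyUpTo (countWithLargest m N) (suc k)) ℕ.+ count m n)
           ([s+n]/s≡1+n/s (suc m) n) ⟩
    countWithLargest m N 0 ℕ.+ (countWithLargest m N 1 ℕ.+ rest) ℕ.+ count m n
      ≡⟨ cong₂ (λ x y → x ℕ.+ (y ℕ.+ rest) ℕ.+ count m n)
           (countWithLargest-allowed m N 0 λ ()) (countWithLargest-once m N Csm) ⟩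
    count m N ℕ.+ rest ℕ.+ count m n
      ≡⟨ trans (ℕ.+-assoc (count m N) rest _) (cong (count m N ℕ.+_) (ℕ.+-comm rest _)) ⟩
    count m N ℕ.+ (count m n ℕ.+ rest)
      ≡⟨ cong (λ x → count m N ℕ.+ (count m n ℕ.+ sum x)) (applyUpTo-cong rest≡ (n / suc m)) ⟩
    count m N ℕ.+ sumMultiples (suc m) (count m) n
      ≡⟨ sumMultiples-+ (suc m) n (count m) ⟨
    sumMultiples (suc m) (count m) N ∎
    where
    open ≡-Reasoning
    N rest : ℕ
    N    = suc m ℕ.+ n
    rest = sum (applyUpTo (λ j → countWithLargest m N (suc (suc j))) (n / suc m))
    rest≡ : ∀ j → countWithLargest m N (suc (suc j)) ≡ count m (n ∸ suc j ℕ.* suc m)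
    rest≡ j = trans (countWithLargest-allowed m N (suc (suc j)) λ ())
                    (cong (count m) (ℕ.[m+n]∸[m+o]≡n∸o (suc m) n (suc j ℕ.* suc m)))

  -- Recurrences for the generating functions

  countSeries : ℕ → Series
  countSeries m n = + count m n

  multiplesSeries : ℕ → Series
  multiplesSeries m n = + sumMultiples (suc m) (count m) n

  -- Supplies the hypothesis of `geometric`, in place of a division by 1 - q^(m+1).
  multiplesSeries-geometric : ∀ m →
    multiplesSeries m ≗ countSeries m ⊕ (q^ suc m ⊛ multiplesSeries m)
  multiplesSeries-geometric m = byShift (suc m)
    (λ {n} n<s → trans (cong +_ (sumMultiples-< (count m) n<s))
      (sym (trans (cong (_+_ (+ count m n)) (q^⊛-< (multiplesSeries m) n<s)) (ℤ.+-identityʳ _))))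
    (λ n → trans (cong +_ (sumMultiples-+ (suc m) n (count m)))
      (trans (ℤ.pos-+ (count m (suc m ℕ.+ n)) _)
        (cong (_+_ (+ count m (suc m ℕ.+ n))) (sym (q^⊛-+ (suc m) n (multiplesSeries m))))))

  countSeries-restricted : ∀ m → C (suc m) →
    countSeries (suc m) ⊕ (q^ suc m ⊛ countSeries m) ≗ multiplesSeries m
  countSeries-restricted m Csm = byShift (suc m)
    (λ {n} n<s → trans (cong₂ _+_ (cong +_ (count-restricted-< m n<s)) (q^⊛-< (countSeries m) n<s))
      (trans (ℤ.+-identityʳ _) (sym (cong +_ (sumMultiples-< (count m) n<s)))))
    (λ n → trans (cong (_+_ (+ count (suc m) (suc m ℕ.+ n))) (q^⊛-+ (suc m) n (countSeries m)))
      (trans (sym (ℤ.pos-+ (count (suc m) (suc m ℕ.+ n)) _))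
             (cong +_ (count-restricted-+ m n Csm))))

  signedSeries : ℕ → Series
  signedSeries m = signed (countSeries m)

  signedSeries-free : ∀ m → ¬ C (suc m) →
    signedSeries (suc m) ⊛ (𝟙 ⊖ signed (q^ suc m)) ≗ signedSeries m
  signedSeries-free m ¬C = signed-⊛-𝟙⊖ (countSeries (suc m)) (countSeries m) (q^ suc m) λ n →
    trans (⊛-congʳ (𝟙 ⊖ q^ suc m) (λ k → cong +_ (count-free m ¬C k)) n)
          (geometric (multiplesSeries m) (countSeries m) (q^ suc m) (multiplesSeries-geometric m) n)

  signedSeries-restricted : ∀ m → C (suc m) →
    signedSeries (suc m) ⊛ (𝟙 ⊖ signed (q^ suc m)) ≗ signedSeries m ⊛ κ (signed (q^ suc m))
  signedSeries-restricted m Csm n = trans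
    (signed-⊛-𝟙⊖ (countSeries (suc m)) (countSeries m ⊛ κ (q^ suc m)) (q^ suc m)
      (geometricWithoutLinear (multiplesSeries m) (countSeries m) (countSeries (suc m)) (q^ suc m)
        (multiplesSeries-geometric m) (countSeries-restricted m Csm)) n)
    (trans (signed-⊛ (countSeries m) (κ (q^ suc m)) n)
           (⊛-congˡ (signedSeries m) (signed-κ (q^ suc m)) n))

  -- A part larger than n does not fit into a partition of n: the quotient `n / suc m` is 0, only
  -- the block j = 0 remains, and the lists of partitions themselves agree.
  countSeries-stable : ∀ {m n} → n ≤ m → countSeries m n ≡ countSeries n n
  countSeries-stable n≤m = cong (λ ps → + length (filter noneOnce? ps)) (stable (ℕ.≤⇒≤′ n≤m))
    where
    stable : ∀ {m n} → n ℕ.≤′ m → boundedPartitions m n ≡ boundedPartitions n n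
    stable ℕ.≤′-refl = refl
    stable {suc m} {n} (ℕ.≤′-step n≤′m) rewrite m<n⇒m/n≡0 (ℕ.s≤s (ℕ.≤′⇒≤ n≤′m)) =
      trans (++-identityʳ _) (trans (map-id (boundedPartitions m n)) (stable n≤′m))

-- Finite products at level N

-- Writes the last factor of the products for r = 2k in terms of x = q^(2N+2); needed for r = 4, 6
-- and 12.
q^-2*suc : ∀ k N → q^ (k ℕ.* 2 ℕ.* suc N) ≗ (q^ (suc N ℕ.* 2)) ↑ k
q^-2*suc k N n = trans
  (cong (λ l → (q^ l) n) (trans (ℕ.*-assoc k 2 (suc N)) (cong (k ℕ.*_) (ℕ.*-comm 2 (suc N)))))
  (q^-* k (suc N ℕ.* 2) n)

partialProduct-suc : ∀ r N {z} → q^ (r ℕ.* suc N) ≗ z →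
                     partialProduct r (suc N) ≗ partialProduct r N ⊛ (𝟙 ⊖ z)
partialProduct-suc r N q^≗z = ⊛-congˡ (partialProduct r N)
  (λ n → cong (ℤ._-_ (𝟙 n)) (q^≗z n))

partialProduct-2+ : ∀ r M {y x} → q^ (r ℕ.* suc M) ≗ y → q^ (r ℕ.* (2 ℕ.+ M)) ≗ x →
                    partialProduct r (2 ℕ.+ M) ≗ partialProduct r M ⊛ (𝟙 ⊖ y) ⊛ (𝟙 ⊖ x)
partialProduct-2+ r M {y} {x} q^≗y q^≗x n = trans
  (partialProduct-suc r (suc M) q^≗x n)
  (⊛-congʳ (𝟙 ⊖ x) (partialProduct-suc r M q^≗y) n)

-- The two copies of f₂ are cut off differently: passing to the next level, the first gains 1 - y²
-- and 1 - x², the second gains 1 - x. Writing `N * 2` makes `suc N * 2` compute to two successors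
-- of `N * 2`.
denominator : ℕ → Series
denominator N = partialProduct 2 (N ℕ.* 2) ⊛ partialProduct 2 N ⊛ partialProduct 6 N

numerator : ℕ → ℕ → ℕ → Series
numerator a b N = partialProduct a (N ℕ.* 2) ⊛ partialProduct b N

denominator-suc : ∀ N → let y = q^ suc (N ℕ.* 2); x = q^ (suc N ℕ.* 2) in
  denominator (suc N) ≗
    partialProduct 2 (N ℕ.* 2) ⊛ (𝟙 ⊖ y ↑ 2) ⊛ (𝟙 ⊖ x ↑ 2)
      ⊛ (partialProduct 2 N ⊛ (𝟙 ⊖ x)) ⊛ (partialProduct 6 N ⊛ (𝟙 ⊖ x ↑ 3))
denominator-suc N =
  ⊛-cong (⊛-cong (partialProduct-2+ 2 (N ℕ.* 2) (q^-* 2 (suc (N ℕ.* 2))) (q^-* 2 (suc N ℕ.* 2)))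
                 (partialProduct-suc 2 N λ n → cong (λ k → (q^ k) n) (ℕ.*-comm 2 (suc N))))
         (partialProduct-suc 6 N (q^-2*suc 3 N))

-- Parity and signs

-1^even : ∀ N → -1ℤ ^ (N ℕ.* 2) ≡ 1ℤ
-1^even zero    = refl
-1^even (suc N) = cong (λ s → -1ℤ * (-1ℤ * s)) (-1^even N)

signed-q^-even : ∀ N → signed (q^ (N ℕ.* 2)) ≗ q^ (N ℕ.* 2)
signed-q^-even N n = trans (signed-q^ (N ℕ.* 2) n)
  (trans (cong (_* (q^ (N ℕ.* 2)) n) (-1^even N)) (ℤ.*-identityˡ _))

signed-q^-odd : ∀ N → signed (q^ suc (N ℕ.* 2)) ≗ ⊖ (q^ suc (N ℕ.* 2))
signed-q^-odd N n = trans (signed-q^ (suc (N ℕ.* 2)) n)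
  (trans (cong (λ s → -1ℤ * s * (q^ suc (N ℕ.* 2)) n) (-1^even N)) (ℤ.-1*i≡-i _))

2∤odd : ∀ N → ¬ 2 ∣ suc (N ℕ.* 2)
2∤odd N 2∣ = case ∣1⇒≡1 (∣m+n∣m⇒∣n (subst (2 ∣_) (ℕ.+-comm 1 (N ℕ.* 2)) 2∣) (n∣m*n N)) of λ ()

𝟙⊖-cong : ∀ {a b} → a ≗ b → 𝟙 ⊖ a ≗ 𝟙 ⊖ b
𝟙⊖-cong a≗b n = cong (ℤ._-_ (𝟙 n)) (a≗b n)

κ-cong : ∀ {a b} → a ≗ b → κ a ≗ κ b
κ-cong {a} {b} a≗b n = cong₂ _+_ (𝟙⊖-cong a≗b n) (⊛-cong a≗b (⊛-congʳ 𝟙 a≗b) n)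

≗-÷ : ∀ {a c} d → d 0 ≡ 1ℤ → a ⊛ d ≗ c → a ≗ c ÷ d
≗-÷ {a} {c} d d₀≡1 a⊛d≗c n = begin
  a n                   ≡⟨ trans (⊛-comm a 𝟙 n) (⊛-identityˡ a n) ⟨
  (a ⊛ 𝟙) n             ≡⟨ ⊛-congˡ a (⊛-recip d d₀≡1) n ⟨
  (a ⊛ (d ⊛ recip d)) n ≡⟨ ⊛-assoc a d (recip d) n ⟨
  (a ⊛ d ⊛ recip d) n   ≡⟨ ⊛-congʳ (recip d) a⊛d≗c n ⟩
  (c ÷ d) n             ∎
  where open ≡-Reasoning

-- From finite levels to the limit

module _ {C : ℕ → Set} (C? : Decidable C) where
  open NoPartOnce C?

  -- At level 0 all products are empty and the empty partition is the only one counted.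
  signedSeries⊛denominator-zero : ∀ a b → signedSeries 0 ⊛ denominator 0 ≗ numerator a b 0
  signedSeries⊛denominator-zero a b n = trans
    (⊛-congʳ (𝟙 ⊛ 𝟙 ⊛ 𝟙) signedSeries-zero n)
    (trans (⊛-identityˡ (𝟙 ⊛ 𝟙 ⊛ 𝟙) n) (⊛-congʳ 𝟙 (⊛-identityˡ 𝟙) n))
    where
    signedSeries-zero : signedSeries 0 ≗ 𝟙
    signedSeries-zero zero    = refl
    signedSeries-zero (suc n) = ℤ.*-zeroʳ (-1ℤ ^ suc n)

  limit : ∀ a b .{{_ : NonZero a}} .{{_ : NonZero b}} →
    (∀ N → signedSeries (N ℕ.* 2) ⊛ denominator N ≗ numerator a b N) →
    signed (λ n → countSeries n n) ≗ (f a ⊛ f b) ÷ (f 2 ⊛ f 2 ⊛ f 6)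
  -- The constant term of the denominator evaluates to 1. For the coefficient of q^n, exactness is
  -- used at level n, where both cutoffs, n and 2n, cover all degrees up to n.
  limit a b exact = ≗-÷ (f 2 ⊛ f 2 ⊛ f 6) refl λ n →
    trans (⊛-cong-≤ n (λ {k} k≤n → cong (-1ℤ ^ k *_) (sym (countSeries-stable (≤*2 k≤n))))
             (⊛-cong-≤ n (⊛-cong-≤ n (λ k≤n → f≡ 2 (≤*2 k≤n)) (f≡ 2)) (f≡ 6)) ℕ.≤-refl)
      (trans (exact n n)
        (sym (⊛-cong-≤ n (λ k≤n → f≡ a (≤*2 k≤n)) (f≡ b) ℕ.≤-refl)))
    where
    ≤*2 : ∀ {k n} → k ≤ n → k ≤ n ℕ.* 2
    ≤*2 {n = n} k≤n = ℕ.≤-trans k≤n (ℕ.m≤m*n n 2)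
    f≡ : ∀ r .{{_ : NonZero r}} {k N} → k ≤ N → f r k ≡ partialProduct r N k
    f≡ r k≤N = sym (partialProduct-stable r k≤N)

-- The even and the odd restriction

odd? : Decidable (λ k → ¬ 2 ∣ k)
odd? k = ¬? (2 ∣? k)

module Pend = NoPartOnce (2 ∣?_)
module Pond = NoPartOnce odd?

pend-exact : ∀ N → Pend.signedSeries (N ℕ.* 2) ⊛ denominator N ≗ numerator 1 12 N
pend-exact zero    = signedSeries⊛denominator-zero (2 ∣?_) 1 12
pend-exact (suc N) n = begin
  (P₂ ⊛ denominator (suc N)) n
    ≡⟨ ⊛-congˡ P₂ (denominator-suc N) n ⟩
  (P₂ ⊛ (partialProduct 2 (N ℕ.* 2) ⊛ (𝟙 ⊖ y ↑ 2) ⊛ (𝟙 ⊖ x ↑ 2)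
     ⊛ (partialProduct 2 N ⊛ (𝟙 ⊖ x)) ⊛ (partialProduct 6 N ⊛ (𝟙 ⊖ x ↑ 3)))) n
    ≡⟨ pendStep P₀ P₁ P₂ (partialProduct 2 (N ℕ.* 2)) (partialProduct 2 N) (partialProduct 6 N)
         (partialProduct 1 (N ℕ.* 2)) (partialProduct 12 N) y x (pend-exact N) odd even n ⟩
  (partialProduct 1 (N ℕ.* 2) ⊛ (𝟙 ⊖ y) ⊛ (𝟙 ⊖ x) ⊛ (partialProduct 12 N ⊛ (𝟙 ⊖ x ↑ 6))) n
    ≡⟨ ⊛-cong (partialProduct-2+ 1 (N ℕ.* 2) (1* (suc (N ℕ.* 2))) (1* (suc N ℕ.* 2)))
              (partialProduct-suc 12 N (q^-2*suc 6 N)) n ⟨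
  numerator 1 12 (suc N) n ∎
  where
  open ≡-Reasoning
  y x P₀ P₁ P₂ : Series
  y  = q^ suc (N ℕ.* 2)
  x  = q^ (suc N ℕ.* 2)
  P₀ = Pend.signedSeries (N ℕ.* 2)
  P₁ = Pend.signedSeries (suc (N ℕ.* 2))
  P₂ = Pend.signedSeries (suc N ℕ.* 2)
  1* : ∀ k → q^ (1 ℕ.* k) ≗ q^ k
  1* k n = cong (λ l → (q^ l) n) (ℕ.*-identityˡ k)
  -- The part 2N + 1 is unrestricted here and 2N + 2 is restricted; the sign substitution turns
  -- their monomials into -y and x.
  odd : P₁ ⊛ (𝟙 ⊖ (⊖ y)) ≗ P₀
  odd n = trans (⊛-congˡ P₁ (𝟙⊖-cong (λ k → sym (signed-q^-odd N k))) n)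
                (Pend.signedSeries-free (N ℕ.* 2) (2∤odd N) n)
  even : P₂ ⊛ (𝟙 ⊖ x) ≗ P₁ ⊛ κ x
  even n = trans (⊛-congˡ P₂ (𝟙⊖-cong (λ k → sym (signed-q^-even (suc N) k))) n)
    (trans (Pend.signedSeries-restricted (suc (N ℕ.* 2)) (n∣m*n (suc N)) n)
           (⊛-congˡ P₁ (κ-cong (signed-q^-even (suc N))) n))

pond-exact : ∀ N → Pond.signedSeries (N ℕ.* 2) ⊛ denominator N ≗ numerator 3 4 N
pond-exact zero    = signedSeries⊛denominator-zero odd? 3 4
pond-exact (suc N) n = begin
  (P₂ ⊛ denominator (suc N)) n
    ≡⟨ ⊛-congˡ P₂ (denominator-suc N) n ⟩
  (P₂ ⊛ (partialProduct 2 (N ℕ.* 2) ⊛ (𝟙 ⊖ y ↑ 2) ⊛ (𝟙 ⊖ x ↑ 2)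
     ⊛ (partialProduct 2 N ⊛ (𝟙 ⊖ x)) ⊛ (partialProduct 6 N ⊛ (𝟙 ⊖ x ↑ 3)))) n
    ≡⟨ pondStep P₀ P₁ P₂ (partialProduct 2 (N ℕ.* 2)) (partialProduct 2 N) (partialProduct 6 N)
         (partialProduct 3 (N ℕ.* 2)) (partialProduct 4 N) y x (pond-exact N) odd even n ⟩
  (partialProduct 3 (N ℕ.* 2) ⊛ (𝟙 ⊖ y ↑ 3) ⊛ (𝟙 ⊖ x ↑ 3) ⊛ (partialProduct 4 N ⊛ (𝟙 ⊖ x ↑ 2))) n
    ≡⟨ ⊛-cong (partialProduct-2+ 3 (N ℕ.* 2) (q^-* 3 (suc (N ℕ.* 2))) (q^-* 3 (suc N ℕ.* 2)))
              (partialProduct-suc 4 N (q^-2*suc 2 N)) n ⟨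
  numerator 3 4 (suc N) n ∎
  where
  open ≡-Reasoning
  y x P₀ P₁ P₂ : Series
  y  = q^ suc (N ℕ.* 2)
  x  = q^ (suc N ℕ.* 2)
  P₀ = Pond.signedSeries (N ℕ.* 2)
  P₁ = Pond.signedSeries (suc (N ℕ.* 2))
  P₂ = Pond.signedSeries (suc N ℕ.* 2)
  -- The roles are exchanged: the odd part contributes the factor `κ`, now evaluated at -y.
  odd : P₁ ⊛ (𝟙 ⊖ (⊖ y)) ≗ P₀ ⊛ κ (⊖ y)
  odd n = trans (⊛-congˡ P₁ (𝟙⊖-cong (λ k → sym (signed-q^-odd N k))) n)
    (trans (Pond.signedSeries-restricted (N ℕ.* 2) (2∤odd N) n)
           (⊛-congˡ P₀ (κ-cong (signed-q^-odd N)) n))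
  even : P₂ ⊛ (𝟙 ⊖ x) ≗ P₁
  even n = trans (⊛-congˡ P₂ (𝟙⊖-cong (λ k → sym (signed-q^-even (suc N) k))) n)
                 (Pond.signedSeries-free (suc (N ℕ.* 2)) (λ 2∤ → 2∤ (n∣m*n (suc N))) n)

theorem2p3 : ((λ n → -1ℤ ^ n * + pend n) ≗ (f 1 ⊛ f 12) ÷ (f 2 ⊛ f 2 ⊛ f 6))
    × ((λ n → -1ℤ ^ n * + pond n) ≗ (f 3 ⊛ f 4) ÷ (f 2 ⊛ f 2 ⊛ f 6))
theorem2p3 = limit (2 ∣?_) 1 12 pend-exact , limit odd? 3 4 pond-exact
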